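{- There is an absolute constant $C>0$ such that for every integer $n\ge 1$ there exist a positive integer $k\le C\,n^{2/3}$ and a depth three circuit on the variables $x_1,\dots,x_n$ consisting of $\mathrm{MAJ}_k$ gates that computes $\mathrm{MAJ}_n$ correctly on all inputs in $\{0,1\}^n$.
   Context: $\mathrm{MAJ}_n(x_1,\dots,x_n)=1$ if $\sum_{i=1}^n x_i\ge n/2$, and $0$ otherwise. A $\mathrm{MAJ}_k$ gate of a circuit is a threshold gate: with inputs $z_1,\dots,z_r$ it outputs $1$ if $\sum_i c_i z_i\ge t$ and $0$ otherwise, where the weights $c_i$ are positive integers with $\sum_i c_i\le k$ and $t$ is an arbitrary integer threshold (weights and thresholds may differ from gate to gate). A depth three circuit of $\mathrm{MAJ}_k$ gates has three layers of such gates: gates of the first layer take variables among $x_1,\dots,x_n$ as inputs, gates of the second layer take outputs of first-layer gates as inputs, and the third layer is a single output gate taking outputs of second-layer gates as inputs. There is no restriction on the number of gates or on fan-out. -}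

module Defs where

open import Algebra.Properties.Semiring.Sum using (sum)
open import Data.Bool.Base using (Bool; true; false)
open import Data.Fin.Base using (Fin)
open import Data.Integer.Base using (ℤ; +_)
open import Data.Integer.Properties using () renaming (_≤?_ to _≤ℤ?_)
open import Data.Nat.Base using (ℕ; _*_; _≤_; _>_)
open import Data.Nat.Properties using (_≤?_; +-*-semiring)
open import Data.Vec.Functional using (Vector)
open import Relation.Binary.PropositionalEquality.Core using (_≡_)
open import Relation.Nullary.Decidable.Core using (⌊_⌋)

∑ : ∀ {r} → Vector ℕ r → ℕ
∑ = sum +-*-semiring

bit : Bool → ℕ
bit false = 0
bit true  = 1

-- The condition  ∑ xᵢ ≥ n / 2  (exact division, no rounding) is cleared of
-- its denominator.
MAJ : ∀ n → Vector Bool n → Bool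
MAJ n x = ⌊ n ≤? 2 * ∑ (λ i → bit (x i)) ⌋

-- A MAJ_k gate reading from m available wires.  The same wire may be read
-- several times; this only adds up its weights, all of which count towards
-- the bound k.
record Gate (k m : ℕ) : Set where
  field
    fanIn      : ℕ
    input      : Fin fanIn → Fin m
    weight     : Fin fanIn → ℕ
    weight>0   : ∀ i → weight i > 0
    ∑weight≤k  : ∑ weight ≤ k
    threshold  : ℤ

evalGate : ∀ {k m} → Gate k m → Vector Bool m → Bool
evalGate g z = ⌊ threshold ≤ℤ? + ∑ (λ i → weight i * bit (z (input i))) ⌋
  where open Gate g

record DepthThreeCircuit (k n : ℕ) : Set where
  field
    size₁   : ℕ
    size₂   : ℕ
    layer₁  : Fin size₁ → Gate k n
    layer₂  : Fin size₂ → Gate k size₁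
    output  : Gate k size₂

evalCircuit : ∀ {k n} → DepthThreeCircuit k n → Vector Bool n → Bool
evalCircuit c x = evalGate output y₂
  where
  open DepthThreeCircuit c

  y₁ : Vector Bool size₁
  y₁ j = evalGate (layer₁ j) x

  y₂ : Vector Bool size₂
  y₂ j = evalGate (layer₂ j) y₁

Computes : ∀ {k n} → DepthThreeCircuit k n → (Vector Bool n → Bool) → Set
Computes c f = ∀ x → evalCircuit c x ≡ f x

{-# OPTIONS --safe #-}

-- Cut the variables into p ≈ n^(1/3) blocks of at most p² variables, with
-- block sums sᵢ, and let the first layer compute every [ sᵢ > c ] for c < p².
-- For j < p the number f j of pairs (i , u) with sᵢ > u p + j is a sum of p²
-- of these bits.  The thresholds u p + j run through 0, …, p² − 1 exactly once,
-- so the f j add up to the number of ones exactly, while any two of them differ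
-- by at most p.  Hence, unless the answer is already forced, all f j lie in one
-- window of length O(p), and O(p²) gates [ f j > t ] with t in this window
-- determine the sum of the f j.
module Submission where

open import Defs
import Algebra.Properties.Semiring.Sum as SemiringSum
open import Data.Bool.Base using (Bool; true; false)
open import Data.Fin.Base using (Fin; zero; suc; toℕ; _↑ˡ_; _↑ʳ_; combine; remQuot)
open import Data.Fin.Properties using (any?; remQuot-combine; toℕ-combine; toℕ<n)
open import Data.Integer.Base as ℤ using (+≤+)
open import Data.Integer.Properties using (drop‿+≤+)
open import Data.Nat.Base using (ℕ; zero; suc; _+_; _*_; _∸_; _⊓_; _/_; _%_; ⌈_/2⌉; ⌊_/2⌋;
  NonZero; >-nonZero⁻¹; _^_; _≤_; _<_; _≥_; _>_; z≤n; s≤s; s≤s⁻¹)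
open import Data.Nat.DivMod using (m/n*n≤m; m≡m%n+[m/n]*n; m%n<n)
open import Data.Nat.Properties
open import Data.Nat.Tactic.RingSolver using (solve-∀)
open import Data.Product using (Σ-syntax; _×_; _,_)
open import Data.Vec.Functional using (Vector)
open import Function.Base using (_∘_; id)
open import Function.Bundles using (_⇔_; mk⇔)
open import Function.Construct.Composition using (_⇔-∘_)
open import Relation.Binary.PropositionalEquality using (_≡_; refl; sym; trans; cong; subst; module ≡-Reasoning)
open import Relation.Nullary using (Dec; yes; no; contradiction)
open import Relation.Nullary.Decidable using (⌊_⌋; does-⇔; isYes≗does)

private
  module Sum = SemiringSum +-*-semiring

⌊⌋-cong : ∀ {A B : Set} (a? : Dec A) (b? : Dec B) → A ⇔ B → ⌊ a? ⌋ ≡ ⌊ b? ⌋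
⌊⌋-cong a? b? A⇔B = trans (isYes≗does a?) (trans (does-⇔ A⇔B a? b?) (sym (isYes≗does b?)))

[_<_] : ℕ → ℕ → ℕ
[ c < s ] = bit ⌊ suc c ≤? s ⌋

-- Finite sums

∑-cong : ∀ {n} {f g : Vector ℕ n} → (∀ i → f i ≡ g i) → ∑ f ≡ ∑ g
∑-cong = Sum.sum-cong-≗

∑-mono-≤ : ∀ {n} {f g : Vector ℕ n} → (∀ i → f i ≤ g i) → ∑ f ≤ ∑ g
∑-mono-≤ {zero}  f≤g = z≤n
∑-mono-≤ {suc n} f≤g = +-mono-≤ (f≤g zero) (∑-mono-≤ (f≤g ∘ suc))

∑-const : ∀ n c → ∑ {n} (λ _ → c) ≡ n * c
∑-const zero    c = refl
∑-const (suc n) c = cong (c +_) (∑-const n c)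

∑-+-const : ∀ {n} c (f : Vector ℕ n) → ∑ (λ i → c + f i) ≡ n * c + ∑ f
∑-+-const {n} c f = trans (Sum.∑-distrib-+ (λ _ → c) f) (cong (_+ ∑ f) (∑-const n c))

∑-≤-const : ∀ {n c} {f : Vector ℕ n} → (∀ i → f i ≤ c) → ∑ f ≤ n * c
∑-≤-const {n} {c} f≤c = ≤-trans (∑-mono-≤ f≤c) (≤-reflexive (∑-const n c))

∑-≥-const : ∀ {n c} {f : Vector ℕ n} → (∀ i → c ≤ f i) → n * c ≤ ∑ f
∑-≥-const {n} {c} c≤f = ≤-trans (≤-reflexive (sym (∑-const n c))) (∑-mono-≤ c≤f)

∑-split : ∀ m {n} (f : Vector ℕ (m + n)) → ∑ f ≡ ∑ (λ i → f (i ↑ˡ n)) + ∑ (λ i → f (m ↑ʳ i))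
∑-split zero    f = refl
∑-split (suc m) f = trans (cong (f zero +_) (∑-split m (f ∘ suc))) (sym (+-assoc (f zero) _ _))

∑-combine : ∀ m {n} (f : Vector ℕ (m * n)) → ∑ f ≡ ∑ (λ i → ∑ (λ j → f (combine {m} i j)))
∑-combine zero        f = refl
∑-combine (suc m) {n} f = trans (∑-split n f) (cong (∑ (λ j → f (j ↑ˡ (m * n))) +_) (∑-combine m (λ i → f (n ↑ʳ i))))

∑-remQuot : ∀ m {n} (f : Fin m × Fin n → ℕ) →
            ∑ (λ e → f (remQuot {m} n e)) ≡ ∑ (λ i → ∑ (λ j → f (i , j)))
∑-remQuot m {n} f = trans (∑-combine m (λ e → f (remQuot {m} n e)))
  (∑-cong λ i → ∑-cong λ j → cong f (remQuot-combine i j))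

-- Each term of `a` after the first is paired with the preceding term of `b`, so only `a 0` is left
-- over, at cost `c`.
∑-interleave : ∀ N {c} (a b : ℕ → ℕ) → a 0 ≤ c → (∀ u → a (suc u) ≤ b u) →
               ∑ {N} (a ∘ toℕ) ≤ c + ∑ {N} (b ∘ toℕ)
∑-interleave zero    a b a0≤c a≤b = z≤n
∑-interleave (suc N) a b a0≤c a≤b = +-mono-≤ a0≤c (∑-interleave N (a ∘ suc) (b ∘ suc) (a≤b 0) (a≤b ∘ suc))

-- Sums of threshold bits

bit≤1 : ∀ b → bit b ≤ 1
bit≤1 false = z≤n
bit≤1 true  = ≤-refl

[<]-cong : ∀ {c s d t} → (c < s) ⇔ (d < t) → [ c < s ] ≡ [ d < t ]
[<]-cong {c} {s} {d} {t} eqv = cong bit (⌊⌋-cong (suc c ≤? s) (suc d ≤? t) eqv)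

[<]-antitone : ∀ {c d} s → d ≤ c → [ c < s ] ≤ [ d < s ]
[<]-antitone {c} {d} s d≤c with suc c ≤? s | suc d ≤? s
... | no  _   | _       = z≤n
... | yes _   | yes _   = ≤-refl
... | yes c<s | no  d≮s = contradiction (≤-<-trans d≤c c<s) d≮s

-- The bits `[ c < s ]` are the unary expansion of `s`, cut off after `N` digits.
∑[<]≡⊓ : ∀ N s → ∑ {N} (λ c → [ toℕ c < s ]) ≡ s ⊓ N
∑[<]≡⊓ zero    s       = sym (⊓-zeroʳ s)
∑[<]≡⊓ (suc N) zero    = trans (∑-const N 0) (*-zeroʳ N)
∑[<]≡⊓ (suc N) (suc s) = cong suc (trans (∑-cong {N} λ c → [<]-cong (mk⇔ s≤s⁻¹ s≤s)) (∑[<]≡⊓ N s))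

+<⇔<∸ : ∀ L {t} s → (L + t < s) ⇔ (t < s ∸ L)
+<⇔<∸ zero    s       = mk⇔ id id
+<⇔<∸ (suc L) zero    = mk⇔ (λ ()) (λ ())
+<⇔<∸ (suc L) (suc s) = +<⇔<∸ L s ⇔-∘ mk⇔ s≤s⁻¹ s≤s

∑[+<]≡∸⊓ : ∀ N L s → ∑ {N} (λ t → [ L + toℕ t < s ]) ≡ (s ∸ L) ⊓ N
∑[+<]≡∸⊓ N L s = trans (∑-cong {N} λ t → [<]-cong (+<⇔<∸ L s)) (∑[<]≡⊓ N (s ∸ L))

-- Sums of almost equal numbers

-- The projection onto the interval from `L` to `L + w`. The part above `L` is written as the number
-- of the `w` consecutive thresholds from `L` on that `x` exceeds.
clamp : ℕ → ℕ → ℕ → ℕ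
clamp L w x = L + ((x ∸ L) ⊓ w)

clamp-inside : ∀ {L w x} → L ≤ x → x ≤ L + w → clamp L w x ≡ x
clamp-inside {L} {w} {x} L≤x x≤L+w =
  trans (cong (L +_) (m≤n⇒m⊓n≡m (m≤n+o⇒m∸n≤o x L x≤L+w))) (m+[n∸m]≡n L≤x)

clamp-≤ : ∀ {L w x b} → L ≤ b → x ≤ b → clamp L w x ≤ b
clamp-≤ {L} {w} {x} L≤b x≤b =
  ≤-trans (+-monoʳ-≤ L (≤-trans (m⊓n≤m (x ∸ L) w) (∸-monoˡ-≤ L x≤b))) (≤-reflexive (m+[n∸m]≡n L≤b))

clamp-≥ : ∀ {L w x b} → b ≤ L + w → b ≤ x → b ≤ clamp L w x
clamp-≥ {L} {w} {x} {b} b≤L+w b≤x =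
  ≤-trans (m≤n+m∸n b L) (+-monoʳ-≤ L (⊓-glb (∸-monoˡ-≤ L b≤x) (m≤n+o⇒m∸n≤o b L b≤L+w)))

-- If some f j leaves the window, then all f j lie so far on that side that both
-- sums compare with m in the same way.
∑-clamp : ∀ {p q m} L w {A} (f : Fin p → ℕ) → (∀ i j → f i ≤ q + f j) →
          (0 < L → p * (q + L) < m) → m ≤ p * A → q + A ≤ L + w →
          m ≤ ∑ (clamp L w ∘ f) ⇔ m ≤ ∑ f
∑-clamp {p} {q} {m} L w {A} f close low high A≤ with any? (λ j → f j <? L) | any? (λ j → L + w <? f j)
... | yes (j , fj<L) | _ = mk⇔
  (λ m≤ → contradiction (≤-<-trans (∑-≤-const λ i → clamp-≤ {w = w} (m≤n+m L q) (f≤ i)) small) (≤⇒≯ m≤))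
  (λ m≤ → contradiction (≤-<-trans (∑-≤-const f≤) small) (≤⇒≯ m≤))
  where
  small : p * (q + L) < m
  small = low (≤-<-trans z≤n fj<L)

  f≤ : ∀ i → f i ≤ q + L
  f≤ i = ≤-trans (close i j) (+-monoʳ-≤ q (<⇒≤ fj<L))
... | no _ | yes (j , L+w<fj) = mk⇔
  (λ _ → ≤-trans high (∑-≥-const A≤f))
  (λ _ → ≤-trans high (∑-≥-const λ i → clamp-≥ {L} (≤-trans (m≤n+m A q) A≤) (A≤f i)))
  where
  A≤f : ∀ i → A ≤ f i
  A≤f i = +-cancelˡ-≤ q A (f i) (≤-trans A≤ (≤-trans (<⇒≤ L+w<fj) (close j i)))
... | no f≮L | no L+w≮f = mk⇔ (subst (m ≤_) same) (subst (m ≤_) (sym same))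
  where
  same : ∑ (clamp L w ∘ f) ≡ ∑ f
  same = ∑-cong λ i → clamp-inside (≮⇒≥ λ lt → f≮L (i , lt)) (≮⇒≥ λ lt → L+w≮f (i , lt))

-- Each clamped value contains the constant `L`, so `p * L` can be moved into the threshold.
-- Truncation is harmless: if `m` is below `p * L`, both sides hold.
∑-window : ∀ {p} m L w (f : Fin p → ℕ) →
           m ∸ p * L ≤ ∑ (λ j → (f j ∸ L) ⊓ w) ⇔ m ≤ ∑ (clamp L w ∘ f)
∑-window {p} m L w f = mk⇔
  (λ le → ≤-trans (m≤n+m∸n m (p * L)) (≤-trans (+-monoʳ-≤ (p * L) le) (≤-reflexive (sym eq))))
  (λ le → m≤n+o⇒m∸n≤o m (p * L) (≤-trans le (≤-reflexive eq)))
  where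
  eq : ∑ (clamp L w ∘ f) ≡ p * L + ∑ (λ j → (f j ∸ L) ⊓ w)
  eq = ∑-+-const L (λ j → (f j ∸ L) ⊓ w)

-- The sum of `p` values reaches `m` when their average is about `m / p`. The margin `suc p` exceeds
-- the possible spread `p` of the values by one, so a value below the window forces all of them
-- below `m / p`.
windowStart : (p m : ℕ) .{{_ : NonZero p}} → ℕ
windowStart p m = m / p ∸ suc p

-- One margin on each side of `m / p`. A value above the window forces all values to be at least
-- `suc (m / p)`, which is enough for the sum to reach `m`.
windowWidth : ℕ → ℕ
windowWidth p = suc p + suc p

∑-window-exact : ∀ {p} .{{_ : NonZero p}} m (f : Fin p → ℕ) → (∀ i j → f i ≤ p + f j) →
                 let L = windowStart p m in
                 m ∸ p * L ≤ ∑ (λ j → (f j ∸ L) ⊓ windowWidth p) ⇔ m ≤ ∑ f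
∑-window-exact {p} m f close = ∑-clamp L w f close low high wide ⇔-∘ ∑-window m L w f
  where
  L = windowStart p m
  w = windowWidth p

  -- A positive `L` means that the subtraction in `windowStart` was not truncated, so `suc p + L` is
  -- exactly `m / p`.
  low : 0 < L → p * (p + L) < m
  low 0<L = begin-strict
    p * (p + L)     <⟨ *-monoʳ-< p (n<1+n (p + L)) ⟩
    p * (suc p + L) ≡⟨ cong (p *_) (m+[n∸m]≡n {suc p} {m / p} (<⇒≤ (m∸n≢0⇒n<m {m / p} (>⇒≢ 0<L)))) ⟩
    p * (m / p)     ≡⟨ *-comm p (m / p) ⟩
    m / p * p       ≤⟨ m/n*n≤m m p ⟩
    m               ∎
    where open ≤-Reasoning

  high : m ≤ p * suc (m / p)
  high = begin
    m                   ≡⟨ m≡m%n+[m/n]*n m p ⟩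
    m % p + m / p * p   ≤⟨ +-monoˡ-≤ (m / p * p) (<⇒≤ (m%n<n m p)) ⟩
    suc (m / p) * p     ≡⟨ *-comm (suc (m / p)) p ⟩
    p * suc (m / p)     ∎
    where open ≤-Reasoning

  wide : p + suc (m / p) ≤ L + w
  wide = begin
    p + suc (m / p)     ≡⟨ +-suc p (m / p) ⟩
    suc p + m / p       ≤⟨ +-monoʳ-≤ (suc p) (m≤n+m∸n (m / p) (suc p)) ⟩
    suc p + (suc p + L) ≡⟨ +-assoc (suc p) (suc p) L ⟨
    w + L               ≡⟨ +-comm w L ⟩
    L + w               ∎
    where open ≤-Reasoning

-- Residue counts

-- `combine u j` stands for `p * u + j`, so the thresholds counted are those below `p * p` with
-- residue `j` modulo `p`.
residueCount : ∀ {p q} → (Fin q → ℕ) → Fin p → ℕ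
residueCount {p} s j = ∑ (λ i → ∑ {p} (λ u → [ toℕ (combine u j) < s i ]))

-- Within one block the thresholds of residues `j` and `k` alternate, so the two counts differ by at
-- most 1; the `q` blocks add up.
residueCount-close : ∀ {p q} (s : Fin q → ℕ) (j k : Fin p) → residueCount s j ≤ q + residueCount s k
residueCount-close {p} {q} s j k = begin
  residueCount s j                                             ≤⟨ ∑-mono-≤ (λ i → block (s i)) ⟩
  ∑ (λ i → 1 + ∑ {p} (λ u → [ toℕ (combine u k) < s i ]))      ≡⟨ ∑-+-const {q} 1 _ ⟩
  q * 1 + residueCount s k                                     ≡⟨ cong (_+ residueCount s k) (*-identityʳ q) ⟩
  q + residueCount s k                                         ∎
  where
  open ≤-Reasoning

  a : Fin p → ℕ → ℕ → ℕ
  a j s u = [ p * u + toℕ j < s ]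

  -- Shifting `u` by one makes the comparison independent of the order of `j` and `k`.
  step : ∀ s u → a j s (suc u) ≤ a k s u
  step s u = [<]-antitone s (begin
    p * u + toℕ k     ≤⟨ +-monoʳ-≤ (p * u) (<⇒≤ (toℕ<n k)) ⟩
    p * u + p         ≡⟨ trans (+-comm (p * u) p) (sym (*-suc p u)) ⟩
    p * suc u         ≤⟨ m≤m+n (p * suc u) (toℕ j) ⟩
    p * suc u + toℕ j ∎)

  rewriteIndex : ∀ s j → ∑ {p} (λ u → [ toℕ (combine u j) < s ]) ≡ ∑ {p} (a j s ∘ toℕ)
  rewriteIndex s j = ∑-cong {p} λ u → cong [_< s ] (toℕ-combine u j)

  block : ∀ s → ∑ {p} (λ u → [ toℕ (combine u j) < s ]) ≤ 1 + ∑ {p} (λ u → [ toℕ (combine u k) < s ])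
  block s = begin
    ∑ {p} (λ u → [ toℕ (combine u j) < s ])     ≡⟨ rewriteIndex s j ⟩
    ∑ {p} (a j s ∘ toℕ)                         ≤⟨ ∑-interleave p (a j s) (a k s) (bit≤1 _) (step s) ⟩
    1 + ∑ {p} (a k s ∘ toℕ)                     ≡⟨ cong suc (rewriteIndex s k) ⟨
    1 + ∑ {p} (λ u → [ toℕ (combine u k) < s ]) ∎

-- Division with remainder by `p` writes each threshold below `p * p` as `p * u + j` exactly once,
-- so every block recovers its full unary expansion; `s i ≤ p * p` ensures that nothing is cut off.
∑-residueCount : ∀ {p q} (s : Fin q → ℕ) → (∀ i → s i ≤ p * p) → ∑ (residueCount {p} s) ≡ ∑ s
∑-residueCount {p} {q} s s≤p² = begin
  ∑ (residueCount {p} s)                                             ≡⟨ Sum.∑-comm {p} {q} _ ⟩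
  ∑ (λ i → ∑ {p} (λ j → ∑ {p} (λ u → [ toℕ (combine u j) < s i ]))) ≡⟨ ∑-cong block ⟩
  ∑ s                                                                ∎
  where
  open ≡-Reasoning

  block : ∀ i → ∑ {p} (λ j → ∑ {p} (λ u → [ toℕ (combine u j) < s i ])) ≡ s i
  block i = begin
    ∑ {p} (λ j → ∑ {p} (λ u → [ toℕ (combine u j) < s i ])) ≡⟨ Sum.∑-comm {p} {p} _ ⟩
    ∑ {p} (λ u → ∑ {p} (λ j → [ toℕ (combine u j) < s i ])) ≡⟨ ∑-combine p (λ c → [ toℕ c < s i ]) ⟨
    ∑ {p * p} (λ c → [ toℕ c < s i ])                        ≡⟨ ∑[<]≡⊓ (p * p) (s i) ⟩
    s i ⊓ (p * p)                                            ≡⟨ m≤n⇒m⊓n≡m (s≤p² i) ⟩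
    s i                                                      ∎

-- Partitions into blocks of bounded size

-- Disjointness and covering are both encoded in `∑-partition`: for the indicator function of a
-- point it says that the point is hit exactly once.
record Partition (q b n : ℕ) : Set where
  field
    size        : Fin q → ℕ
    size≤b      : ∀ i → size i ≤ b
    elem        : ∀ i → Fin (size i) → Fin n
    ∑-partition : ∀ (f : Vector ℕ n) → ∑ (λ i → ∑ (f ∘ elem i)) ≡ ∑ f

-- Greedy: full blocks of size `b` are split off until the rest fits into one block, and all later
-- blocks stay empty.
partition : ∀ q b {n} → n ≤ q * b → Partition q b n
partition zero b z≤n = record { size = λ () ; size≤b = λ () ; elem = λ () ; ∑-partition = λ _ → refl }
partition (suc q) b {n} n≤ with n ≤? b
... | yes n≤b = record { size = size′ ; size≤b = size≤b′ ; elem = elem′ ; ∑-partition = ∑-partition′ }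
  where
  size′ : Fin (suc q) → ℕ
  size′ zero    = n
  size′ (suc _) = 0

  size≤b′ : ∀ i → size′ i ≤ b
  size≤b′ zero    = n≤b
  size≤b′ (suc _) = z≤n

  elem′ : ∀ i → Fin (size′ i) → Fin n
  elem′ zero    = id
  elem′ (suc _) = λ ()

  ∑-partition′ : ∀ f → ∑ (λ i → ∑ (f ∘ elem′ i)) ≡ ∑ f
  ∑-partition′ f = trans (cong (∑ f +_) (trans (∑-const q 0) (*-zeroʳ q))) (+-identityʳ (∑ f))
... | no n≰b with m≤n⇒∃[o]m+o≡n (<⇒≤ (≰⇒> n≰b))
... | r , refl = record { size = size′ ; size≤b = size≤b′ ; elem = elem′ ; ∑-partition = ∑-partition′ }
  where
  open Partition (partition q b {r} (+-cancelˡ-≤ b r (q * b) n≤))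

  size′ : Fin (suc q) → ℕ
  size′ zero    = b
  size′ (suc i) = size i

  size≤b′ : ∀ i → size′ i ≤ b
  size≤b′ zero    = ≤-refl
  size≤b′ (suc i) = size≤b i

  elem′ : ∀ i → Fin (size′ i) → Fin (b + r)
  elem′ zero    = _↑ˡ r
  elem′ (suc i) = λ v → b ↑ʳ elem i v

  ∑-partition′ : ∀ f → ∑ (λ i → ∑ (f ∘ elem′ i)) ≡ ∑ f
  ∑-partition′ f = trans (cong (∑ (λ v → f (v ↑ˡ r)) +_) (∑-partition (λ v → f (b ↑ʳ v)))) (sym (∑-split b f))

-- The circuit

countGate : ∀ {k m r} → r ≤ k → (Fin r → Fin m) → ℕ → Gate k m
countGate {r = r} r≤k wire t = record
  { fanIn     = r
  ; input     = wire
  ; weight    = λ _ → 1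
  ; weight>0  = λ _ → ≤-refl
  ; ∑weight≤k = ≤-trans (≤-reflexive (trans (∑-const r 1) (*-identityʳ r))) r≤k
  ; threshold = ℤ.+ t
  }

evalGate-countGate : ∀ {k m r} (r≤k : r ≤ k) (wire : Fin r → Fin m) t z →
                     evalGate (countGate r≤k wire t) z ≡ ⌊ t ≤? ∑ (bit ∘ z ∘ wire) ⌋
evalGate-countGate r≤k wire t z = ⌊⌋-cong _ _ (mk⇔
  (λ le → ≤-trans (drop‿+≤+ le) (≤-reflexive eq))
  (λ le → +≤+ (≤-trans le (≤-reflexive (sym eq)))))
  where
  eq : ∑ (λ i → 1 * bit (z (wire i))) ≡ ∑ (bit ∘ z ∘ wire)
  eq = ∑-cong λ i → *-identityˡ (bit (z (wire i)))

module _ (p n m : ℕ) .{{_ : NonZero p}} {k : ℕ} (n≤p³ : n ≤ p * (p * p))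
         (p²≤k : p * p ≤ k) (out≤k : p * windowWidth p ≤ k) where

  private
    -- The window depends on `p` and `m` only, not on the input, so it can be built into the gates.
    L = windowStart p m
    w = windowWidth p

  open Partition (partition p (p * p) n≤p³)

  blockGate : Fin p × Fin (p * p) → Gate k n
  blockGate (i , c) = countGate (≤-trans (size≤b i) p²≤k) (elem i) (suc (toℕ c))

  -- The address of the first-layer gate for block `i` and threshold `p * u + j`.
  residueWire : Fin p → Fin p × Fin p → Fin (p * (p * p))
  residueWire j (i , u) = combine i (combine u j)

  residueGate : Fin p × Fin w → Gate k (p * (p * p))
  residueGate (j , t) = countGate p²≤k (residueWire j ∘ remQuot {p} p) (suc (L + toℕ t))

  thresholdCircuit : DepthThreeCircuit k n
  thresholdCircuit = record
    { size₁  = p * (p * p)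
    ; size₂  = p * w
    ; layer₁ = blockGate ∘ remQuot {p} (p * p)
    ; layer₂ = residueGate ∘ remQuot {p} w
    -- The output gate sees only the parts of the `f j` above `L`, hence the threshold lowered by
    -- `p * L`.
    ; output = countGate out≤k id (m ∸ p * L)
    }

  thresholdCircuit-computes : Computes thresholdCircuit (λ x → ⌊ m ≤? ∑ (bit ∘ x) ⌋)
  thresholdCircuit-computes x = begin
    evalCircuit thresholdCircuit x           ≡⟨ evalGate-countGate out≤k id (m ∸ p * L) y₂ ⟩
    ⌊ m ∸ p * L ≤? ∑ (bit ∘ y₂) ⌋            ≡⟨ cong (λ S → ⌊ m ∸ p * L ≤? S ⌋) ∑y₂ ⟩
    ⌊ m ∸ p * L ≤? ∑ (λ j → (f j ∸ L) ⊓ w) ⌋ ≡⟨ ⌊⌋-cong _ _ (∑-window-exact m f (residueCount-close s)) ⟩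
    ⌊ m ≤? ∑ f ⌋                             ≡⟨ cong (λ S → ⌊ m ≤? S ⌋) (∑-residueCount {p} s s≤p²) ⟩
    ⌊ m ≤? ∑ s ⌋                             ≡⟨ cong (λ S → ⌊ m ≤? S ⌋) (∑-partition (bit ∘ x)) ⟩
    ⌊ m ≤? ∑ (bit ∘ x) ⌋                     ∎
    where
    open ≡-Reasoning

    y₁ : Vector Bool (p * (p * p))
    y₁ e = evalGate (blockGate (remQuot {p} (p * p) e)) x

    y₂ : Vector Bool (p * w)
    y₂ e = evalGate (residueGate (remQuot {p} w e)) y₁

    s : Fin p → ℕ
    s i = ∑ (bit ∘ x ∘ elem i)

    f : Fin p → ℕ
    f = residueCount s

    s≤p² : ∀ i → s i ≤ p * p
    s≤p² i = ≤-trans (∑-≤-const λ v → bit≤1 (x (elem i v))) (≤-trans (≤-reflexive (*-identityʳ (size i))) (size≤b i))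

    y₁-combine : ∀ i c → bit (y₁ (combine i c)) ≡ [ toℕ c < s i ]
    y₁-combine i c = cong bit (trans
      (cong (λ e → evalGate (blockGate e) x) (remQuot-combine i c))
      (evalGate-countGate (≤-trans (size≤b i) p²≤k) (elem i) (suc (toℕ c)) x))

    ∑y₁ : ∀ j → ∑ (bit ∘ y₁ ∘ residueWire j ∘ remQuot {p} p) ≡ f j
    ∑y₁ j = trans (∑-remQuot p (bit ∘ y₁ ∘ residueWire j))
      (∑-cong {p} λ i → ∑-cong {p} λ u → y₁-combine i (combine u j))

    ∑y₂ : ∑ (bit ∘ y₂) ≡ ∑ (λ j → (f j ∸ L) ⊓ w)
    ∑y₂ = begin
      ∑ (bit ∘ y₂)                                            ≡⟨ ∑-remQuot p (λ e → bit (evalGate (residueGate e) y₁)) ⟩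
      ∑ (λ j → ∑ (λ t → bit (evalGate (residueGate (j , t)) y₁))) ≡⟨ ∑-cong {p} (λ j → ∑-cong {w} λ t → cong bit (gate j t)) ⟩
      ∑ (λ j → ∑ {w} (λ t → [ L + toℕ t < f j ]))             ≡⟨ ∑-cong {p} (λ j → ∑[+<]≡∸⊓ w L (f j)) ⟩
      ∑ (λ j → (f j ∸ L) ⊓ w)                                 ∎
      where
      gate : ∀ j t → evalGate (residueGate (j , t)) y₁ ≡ ⌊ suc (L + toℕ t) ≤? f j ⌋
      gate j t = trans
        (evalGate-countGate p²≤k (residueWire j ∘ remQuot {p} p) (suc (L + toℕ t)) y₁)
        (cong (λ S → ⌊ suc (L + toℕ t) ≤? S ⌋) (∑y₁ j))

-- Majority and the choice of parameters

MAJ-threshold : ∀ n x → MAJ n x ≡ ⌊ ⌈ n /2⌉ ≤? ∑ (bit ∘ x) ⌋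
MAJ-threshold n x = ⌊⌋-cong (n ≤? 2 * S) (⌈ n /2⌉ ≤? S) (mk⇔ to from)
  where
  S = ∑ (bit ∘ x)

  2*S≡S+S : 2 * S ≡ S + S
  2*S≡S+S = cong (S +_) (+-identityʳ S)

  to : n ≤ 2 * S → ⌈ n /2⌉ ≤ S
  to le = ≤-trans (⌈n/2⌉-mono (≤-trans le (≤-reflexive 2*S≡S+S))) (≤-reflexive (sym (n≡⌈n+n/2⌉ S)))

  from : ⌈ n /2⌉ ≤ S → n ≤ 2 * S
  from le = begin
    n                   ≡⟨ ⌊n/2⌋+⌈n/2⌉≡n n ⟨
    ⌊ n /2⌋ + ⌈ n /2⌉   ≤⟨ +-mono-≤ (≤-trans (⌊n/2⌋≤⌈n/2⌉ n) le) le ⟩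
    S + S               ≡⟨ 2*S≡S+S ⟨
    2 * S               ∎
    where open ≤-Reasoning

^-distribʳ-* : ∀ m n o → (m * n) ^ o ≡ m ^ o * n ^ o
^-distribʳ-* m n zero    = refl
^-distribʳ-* m n (suc o) =
  trans (cong (m * n *_) (^-distribʳ-* m n o)) ([m*n]*[o*p]≡[m*o]*[n*p] m n (m ^ o) (n ^ o))

-- The root is raised only when its cube falls short. It then at most doubles, so the new cube is at
-- most `8` times a number below the target. Writing it as `suc p` keeps it nonzero.
cubeRoot : ∀ n → Σ[ p ∈ ℕ ] (suc n ≤ suc p * (suc p * suc p) × suc p * (suc p * suc p) ≤ 8 * suc n)
cubeRoot zero = 0 , ≤-refl , s≤s z≤n
cubeRoot (suc n) with cubeRoot n
... | p , lo , hi with suc (suc n) ≤? suc p * (suc p * suc p)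
... | yes lo′ = p , lo′ , ≤-trans hi (*-monoʳ-≤ 8 (n≤1+n (suc n)))
... | no  lo≰ = suc p , ≤-trans (s≤s lo) grow , bound
  where
  grow : suc (suc p * (suc p * suc p)) ≤ suc (suc p) * (suc (suc p) * suc (suc p))
  grow = *-mono-< (n<1+n (suc p)) (*-mono-< (n<1+n (suc p)) (n<1+n (suc p)))

  double : suc (suc p) ≤ 2 * suc p
  double = ≤-trans (+-monoˡ-≤ (suc p) (s≤s (z≤n {p}))) (≤-reflexive (cong (suc p +_) (sym (+-identityʳ (suc p)))))

  cube : ∀ x → (2 * x) * ((2 * x) * (2 * x)) ≡ 8 * (x * (x * x))
  cube = solve-∀

  bound : suc (suc p) * (suc (suc p) * suc (suc p)) ≤ 8 * suc (suc n)
  bound = begin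
    suc (suc p) * (suc (suc p) * suc (suc p)) ≤⟨ *-mono-≤ double (*-mono-≤ double double) ⟩
    2 * suc p * (2 * suc p * (2 * suc p))     ≡⟨ cube (suc p) ⟩
    8 * (suc p * (suc p * suc p))             ≤⟨ *-monoʳ-≤ 8 (<⇒≤ (≰⇒> lo≰)) ⟩
    8 * suc (suc n)                           ∎
    where open ≤-Reasoning

-- The bound of order `n` to the power 2/3 is cubed to avoid fractional exponents. The constant 16
-- is 4 times the power 2/3 of 8.
cube-bound : ∀ p n → p * (p * p) ≤ 8 * n → (4 * (p * p)) ^ 3 ≤ 16 ^ 3 * n ^ 2
cube-bound p n p³≤8n = begin
  (4 * (p * p)) ^ 3            ≡⟨ ^-distribʳ-* 4 (p * p) 3 ⟩
  4 ^ 3 * (p * p) ^ 3          ≡⟨ cong (4 ^ 3 *_) (sixth p) ⟩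
  4 ^ 3 * (p * (p * p)) ^ 2    ≤⟨ *-monoʳ-≤ (4 ^ 3) (^-monoˡ-≤ 2 p³≤8n) ⟩
  4 ^ 3 * (8 * n) ^ 2          ≡⟨ cong (4 ^ 3 *_) (^-distribʳ-* 8 n 2) ⟩
  4 ^ 3 * (8 ^ 2 * n ^ 2)      ≡⟨ *-assoc (4 ^ 3) (8 ^ 2) (n ^ 2) ⟨
  4 ^ 3 * 8 ^ 2 * n ^ 2        ≡⟨ cong (_* n ^ 2) {4 ^ 3 * 8 ^ 2} {16 ^ 3} refl ⟩
  16 ^ 3 * n ^ 2               ∎
  where
  open ≤-Reasoning

  -- The ring solver does not accept _^_, so the powers are unfolded.
  sixth : ∀ x → (x * x) * ((x * x) * ((x * x) * 1)) ≡ (x * (x * x)) * ((x * (x * x)) * 1)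
  sixth = solve-∀

majorityCircuit : ∀ p n .{{_ : NonZero p}} → n ≤ p * (p * p) →
                  Σ[ c ∈ DepthThreeCircuit (4 * (p * p)) n ] Computes c (MAJ n)
majorityCircuit p n n≤p³ =
  thresholdCircuit p n ⌈ n /2⌉ n≤p³ p²≤k out≤k ,
  λ x → trans (thresholdCircuit-computes p n ⌈ n /2⌉ n≤p³ p²≤k out≤k x) (sym (MAJ-threshold n x))
  where
  open ≤-Reasoning

  p²≤k : p * p ≤ 4 * (p * p)
  p²≤k = m≤n*m (p * p) 4

  suc-p≤2p : suc p ≤ p + p
  suc-p≤2p = +-monoˡ-≤ p (>-nonZero⁻¹ p)

  -- The output gate has the largest fan-in, `p * (2 * suc p)`; this is where the factor 4 comes
  -- from, using that `p` is at least 1.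
  out≤k : p * windowWidth p ≤ 4 * (p * p)
  out≤k = begin
    p * (suc p + suc p)         ≤⟨ *-monoʳ-≤ p (+-mono-≤ suc-p≤2p suc-p≤2p) ⟩
    p * ((p + p) + (p + p))     ≡⟨ regroup p ⟩
    4 * (p * p)                 ∎
    where
    regroup : ∀ x → x * ((x + x) + (x + x)) ≡ 4 * (x * x)
    regroup = solve-∀

theorem12 : Σ[ C ∈ ℕ ] (C > 0 × ((n : ℕ) → n ≥ 1 → Σ[ k ∈ ℕ ] (k ≥ 1 × k ^ 3 ≤ C ^ 3 * n ^ 2 × Σ[ c ∈ DepthThreeCircuit k n ] Computes c (MAJ n))))
theorem12 = 16 , s≤s z≤n , λ { (suc n) _ →
  let p , n≤p³ , p³≤8n = cubeRoot n
  in 4 * (suc p * suc p) , s≤s z≤n , cube-bound (suc p) (suc n) p³≤8n , majorityCircuit (suc p) (suc n) n≤p³ }
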